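{- Let $R(q)=\dfrac{(q;q^5)_\infty(q^4;q^5)_\infty}{(q^2;q^5)_\infty(q^3;q^5)_\infty}$ and define the coefficients $A(n)$, $n\ge 0$, by the power series expansion $$\frac{1}{R^5(q)}=\sum_{n=0}^{\infty}A(n)q^n,\qquad |q|<1.$$ Then $A(0)>0$, $A(10)<0$, and $A(15)<0$.
   Context: For complex numbers $a,q$ with $|q|<1$, $(a;q)_\infty:=\prod_{k=0}^{\infty}(1-aq^k)$. The function $R(q)$ is the Rogers-Ramanujan continued fraction without its factor $q^{1/5}$, i.e. $R(q)=\cfrac{1}{1+\cfrac{q}{1+\cfrac{q^2}{1+\cfrac{q^3}{1+\cdots}}}}$, which equals the infinite product $\dfrac{(q;q^5)_\infty(q^4;q^5)_\infty}{(q^2;q^5)_\infty(q^3;q^5)_\infty}$ (a classical identity of Rogers and Ramanujan). Here $R^5(q)$ denotes $(R(q))^5$. -}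

module Defs where

open import Algebra.Bundles.Raw using (RawRing)
import Algebra.Definitions.RawSemiring as RawSemiringDefinitions
open import Data.Fin.Base using (Fin; zero; suc; toℕ)
open import Data.Fin.Properties using (toℕ<n)
open import Data.Integer.Base as ℤ using (ℤ; 0ℤ; 1ℤ)
import Data.Integer.Properties as ℤ
open import Data.Nat.Base as ℕ using (ℕ; zero; suc; _∸_; z≤n; s≤s)
import Data.Nat.Properties as ℕ
open import Data.Vec.Base using (Vec; []; _∷_; head; lookup)
open import Function.Base using (_∘_)
open import Level using (0ℓ)
open import Relation.Binary.PropositionalEquality

open import Algebra.Properties.Monoid.Sum ℤ.+-0-monoid
  using (sum; sum-syntax; sum⁺-syntax; sum-cong-≗; sum-replicate-zero)

-- Formal power series over ℤ: f n is the coefficient of qⁿ.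
Series : Set
Series = ℕ → ℤ

infix  4 _≈_
infixl 6 _+_ _-_
infixl 7 _*_ _/_
infix  8 -_

_≈_ : Series → Series → Set
_≈_ = _≗_

0# 1# q : Series

0# _ = 0ℤ

1# zero    = 1ℤ
1# (suc _) = 0ℤ

q zero    = 0ℤ
q (suc n) = 1# n

_+_ _-_ _*_ : Series → Series → Series
(f + g) n = f n ℤ.+ g n
(f - g) n = f n ℤ.- g n
(f * g) n = ∑[ i ≤ n ] (f (toℕ i) ℤ.* g (n ∸ toℕ i))

-_ : Series → Series
(- f) n = ℤ.- f n

seriesRawRing : RawRing 0ℓ 0ℓ
seriesRawRing = record
  { Carrier = Series ; _≈_ = _≈_
  ; _+_ = _+_ ; _*_ = _*_ ; -_ = -_ ; 0# = 0# ; 1# = 1# }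

open RawSemiringDefinitions (RawRing.rawSemiring seriesRawRing) public
  using (_^_)

-- Long division of power series, for divisors with constant term 1 (the
-- value is meaningless otherwise).  quotients f g n lists the coefficients
-- of f / g of index below n, highest index first.  See /-correct.
quotients : Series → Series → (n : ℕ) → Vec ℤ n
quotients f g zero    = []
quotients f g (suc n) = extend (quotients f g n)
  where
  extend : Vec ℤ n → Vec ℤ (suc n)
  extend cs = (f n ℤ.- ∑[ i < n ] (g (suc (toℕ i)) ℤ.* lookup cs i)) ∷ cs

_/_ : Series → Series → Series
(f / g) n = head (quotients f g (suc n))

-- The finite product (a; b)ₘ = ∏_{k<m} (1 - a bᵏ).
qPoch : Series → Series → ℕ → Series
qPoch a b zero    = 1#
qPoch a b (suc m) = qPoch a b m * (1# - a * b ^ m)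

-- The infinite product (a; b)_∞, for b without constant term: the factors
-- with k > n do not affect the coefficient of qⁿ.  See qPoch-converges.
qPoch∞ : Series → Series → Series
qPoch∞ a b n = qPoch a b (suc n) n

R : Series
R = (qPoch∞ q (q ^ 5) * qPoch∞ (q ^ 4) (q ^ 5))
  / (qPoch∞ (q ^ 2) (q ^ 5) * qPoch∞ (q ^ 3) (q ^ 5))

A : Series
A = 1# / R ^ 5

------------------------------------------------------------------------
-- The quotients are quotients

lookup-quotients : ∀ f g n (i : Fin n) →
  lookup (quotients f g n) i ≡ (f / g) (n ∸ suc (toℕ i))
lookup-quotients f g (suc n) zero    = refl
lookup-quotients f g (suc n) (suc i) = lookup-quotients f g n i

/-correct : ∀ f g → g 0 ≡ 1ℤ → g * (f / g) ≈ f
/-correct f g g₀≡1 n = begin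
  g 0 ℤ.* (f n ℤ.- s) ℤ.+ s′  ≡⟨ cong (λ c → c ℤ.* (f n ℤ.- s) ℤ.+ s′) g₀≡1 ⟩
  1ℤ ℤ.* (f n ℤ.- s) ℤ.+ s′   ≡⟨ cong (ℤ._+ s′) (ℤ.*-identityˡ (f n ℤ.- s)) ⟩
  f n ℤ.- s ℤ.+ s′            ≡⟨ cong (λ c → f n ℤ.- s ℤ.+ c) s′≡s ⟩
  f n ℤ.- s ℤ.+ s             ≡⟨ ℤ.+-assoc (f n) (ℤ.- s) s ⟩
  f n ℤ.+ (ℤ.- s ℤ.+ s)       ≡⟨ cong (λ c → f n ℤ.+ c) (ℤ.+-inverseˡ s) ⟩
  f n ℤ.+ 0ℤ                  ≡⟨ ℤ.+-identityʳ (f n) ⟩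
  f n                         ∎
  where
  open ≡-Reasoning
  s s′ : ℤ
  s  = ∑[ i < n ] (g (suc (toℕ i)) ℤ.* lookup (quotients f g n) i)
  s′ = ∑[ i < n ] (g (suc (toℕ i)) ℤ.* (f / g) (n ∸ suc (toℕ i)))
  s′≡s : s′ ≡ s
  s′≡s = sum-cong-≗ λ i →
    cong (g (suc (toℕ i)) ℤ.*_) (sym (lookup-quotients f g n i))

R-spec : (qPoch∞ (q ^ 2) (q ^ 5) * qPoch∞ (q ^ 3) (q ^ 5)) * R
       ≈ qPoch∞ q (q ^ 5) * qPoch∞ (q ^ 4) (q ^ 5)
R-spec = /-correct (qPoch∞ q (q ^ 5) * qPoch∞ (q ^ 4) (q ^ 5))
                   (qPoch∞ (q ^ 2) (q ^ 5) * qPoch∞ (q ^ 3) (q ^ 5)) refl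

A-spec : R ^ 5 * A ≈ 1#
A-spec = /-correct 1# (R ^ 5) refl

------------------------------------------------------------------------
-- The infinite products converge coefficientwise

*-identityʳ : ∀ f → f * 1# ≈ f
*-identityʳ f zero    = trans (ℤ.+-identityʳ _) (ℤ.*-identityʳ (f 0))
*-identityʳ f (suc n) = begin
  f 0 ℤ.* 0ℤ ℤ.+ ((f ∘ suc) * 1#) n  ≡⟨ cong₂ ℤ._+_ (ℤ.*-zeroʳ (f 0)) (*-identityʳ (f ∘ suc) n) ⟩
  0ℤ ℤ.+ f (suc n)                   ≡⟨ ℤ.+-identityˡ _ ⟩
  f (suc n)                          ∎
  where open ≡-Reasoning

-- f is divisible by qᵏ.
Vanishes : ℕ → Series → Set
Vanishes k f = ∀ i → i ℕ.< k → f i ≡ 0ℤ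

sum-zero : ∀ {n} (t : Fin n → ℤ) → (∀ i → t i ≡ 0ℤ) → sum t ≡ 0ℤ
sum-zero {n} t t≡0 = trans (sum-cong-≗ t≡0) (sum-replicate-zero n)

*-vanishes : ∀ {k} f {g} → Vanishes k g → Vanishes k (f * g)
*-vanishes f {g} g≡0 n n<k =
  sum-zero {suc n} (λ i → f (toℕ i) ℤ.* g (n ∸ toℕ i)) λ i →
  trans (cong (f (toℕ i) ℤ.*_) (g≡0 _ (ℕ.≤-<-trans (ℕ.m∸n≤m n (toℕ i)) n<k)))
        (ℤ.*-zeroʳ (f (toℕ i)))

^-vanishes : ∀ b → b 0 ≡ 0ℤ → ∀ k → Vanishes k (b ^ k)
^-vanishes b b₀≡0 (suc k) n (s≤s n≤k) =
  sum-zero {suc n} (λ i → b (toℕ i) ℤ.* (b ^ k) (n ∸ toℕ i)) term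
  where
  term : ∀ (i : Fin (suc n)) → b (toℕ i) ℤ.* (b ^ k) (n ∸ toℕ i) ≡ 0ℤ
  term zero    = trans (cong (ℤ._* (b ^ k) n) b₀≡0) (ℤ.*-zeroˡ ((b ^ k) n))
  term (suc i) = trans
    (cong (b (suc (toℕ i)) ℤ.*_)
      (^-vanishes b b₀≡0 k _
        (ℕ.<-≤-trans (ℕ.∸-monoʳ-< {n} (s≤s z≤n) (toℕ<n i)) n≤k)))
    (ℤ.*-zeroʳ (b (suc (toℕ i))))

*-1-vanishing : ∀ f g n → Vanishes (suc n) g → (f * (1# - g)) n ≡ f n
*-1-vanishing f g n g≡0 = trans
  (sum-cong-≗ {suc n} λ i → cong (f (toℕ i) ℤ.*_)
    (trans (cong (λ c → 1# (n ∸ toℕ i) ℤ.- c)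
             (g≡0 (n ∸ toℕ i) (s≤s (ℕ.m∸n≤m n (toℕ i)))))
           (ℤ.+-identityʳ (1# (n ∸ toℕ i)))))
  (*-identityʳ f n)

qPoch-converges : ∀ a b → b 0 ≡ 0ℤ →
  ∀ n m → n ℕ.< m → qPoch a b m n ≡ qPoch∞ a b n
qPoch-converges a b b₀≡0 n m n<m = go (ℕ.≤⇒≤′ n<m)
  where
  go : ∀ {m} → suc n ℕ.≤′ m → qPoch a b m n ≡ qPoch∞ a b n
  go ℕ.≤′-refl           = refl
  go (ℕ.≤′-step {m} n<m) = trans
    (*-1-vanishing (qPoch a b m) (a * b ^ m) n λ i i≤n →
      *-vanishes a (^-vanishes b b₀≡0 m) i (ℕ.≤-trans i≤n (ℕ.≤′⇒≤ n<m)))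
    (go n<m)

{-# OPTIONS --safe #-}
-- The coefficients of index below N of sums, products, quotients and infinite
-- products of power series depend only on the coefficients of index below N of
-- the operands.  So A 0, A 10 and A 15 can be computed modulo q¹⁶.  Evaluating
-- A directly is infeasible: a series is a function, whose values are
-- recomputed at each use.  Tabulating every intermediate result as a list of
-- coefficients makes the computation small.
module Submission where

open import Defs
open import Data.Fin.Base using (toℕ)
open import Data.Fin.Properties using (toℕ<n)
open import Data.Integer.Base as ℤ using (ℤ; 0ℤ; _<_; _>_)
import Data.Integer.Properties as ℤ
open import Data.List.Base using (List; []; _∷_; applyUpTo)
open import Data.Nat.Base as ℕ using (ℕ; zero; suc; z<s; s<s⁻¹)
import Data.Nat.Properties as ℕ
open import Data.Product.Base using (_×_; _,_)
open import Data.Vec.Base using (_∷_; head; lookup)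
open import Function.Base using (_∘_)
open import Relation.Binary.PropositionalEquality
open import Relation.Nullary.Decidable using (toWitness)

open import Algebra.Properties.Monoid.Sum ℤ.+-0-monoid using (sum-cong-≗)

infix 4 _≈[mod-q^_]_

-- A record rather than a synonym for the type of its field, so that `N`, `f` and `g` can be read
-- off the type of a congruence instead of being recovered from values such as `f n`.
record _≈[mod-q^_]_ (f : Series) (N : ℕ) (g : Series) : Set where
  field
    at : ∀ {n} → n ℕ.< N → f n ≡ g n

open _≈[mod-q^_]_

≈-refl : ∀ {N f} → f ≈[mod-q^ N ] f
≈-refl .at _ = refl

≈-trans : ∀ {N f g h} → f ≈[mod-q^ N ] g → g ≈[mod-q^ N ] h → f ≈[mod-q^ N ] h
≈-trans f≈g g≈h .at n<N = trans (f≈g .at n<N) (g≈h .at n<N)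

sub-cong : ∀ {N f f′ g g′} → f ≈[mod-q^ N ] f′ → g ≈[mod-q^ N ] g′ →
           f - g ≈[mod-q^ N ] f′ - g′
sub-cong f≈f′ g≈g′ .at n<N = cong₂ ℤ._-_ (f≈f′ .at n<N) (g≈g′ .at n<N)

*-cong : ∀ {N f f′ g g′} → f ≈[mod-q^ N ] f′ → g ≈[mod-q^ N ] g′ →
         f * g ≈[mod-q^ N ] f′ * g′
*-cong f≈f′ g≈g′ .at {n} n<N = sum-cong-≗ {suc n} λ i → cong₂ ℤ._*_
  (f≈f′ .at (ℕ.<-≤-trans (toℕ<n i) n<N))
  (g≈g′ .at (ℕ.≤-<-trans (ℕ.m∸n≤m n (toℕ i)) n<N))

-- The induction compares whole vectors because each new coefficient uses all the earlier ones;
-- `/-cong` then takes heads.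
quotients-cong : ∀ {N f f′ g g′} → f ≈[mod-q^ N ] f′ → g ≈[mod-q^ N ] g′ →
                 ∀ {n} → n ℕ.≤ N → quotients f g n ≡ quotients f′ g′ n
quotients-cong f≈f′ g≈g′ {zero}  _   = refl
quotients-cong f≈f′ g≈g′ {suc n} n<N = cong₂ _∷_
  (cong₂ ℤ._-_ (f≈f′ .at n<N) (sum-cong-≗ {n} λ i → cong₂ ℤ._*_
    -- `toℕ<n i` unfolds to `suc (toℕ i) ≤ n`, so the shifted index into `g` is still below `N`.
    (g≈g′ .at (ℕ.≤-<-trans (toℕ<n i) n<N))
    (cong (λ cs → lookup cs i) cs≡cs′)))
  cs≡cs′
  where cs≡cs′ = quotients-cong f≈f′ g≈g′ (ℕ.<⇒≤ n<N)

/-cong : ∀ {N f f′ g g′} → f ≈[mod-q^ N ] f′ → g ≈[mod-q^ N ] g′ →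
         f / g ≈[mod-q^ N ] f′ / g′
/-cong f≈f′ g≈g′ .at n<N = cong head (quotients-cong f≈f′ g≈g′ n<N)

-- Past the end of the list the default 0 is arbitrary: congruences modulo q^N only see indices
-- below `N`.
coefficient : List ℤ → Series
coefficient []       _       = 0ℤ
coefficient (c ∷ _)  zero    = c
coefficient (_ ∷ cs) (suc n) = coefficient cs n

tabulated : ℕ → Series → Series
tabulated N f = coefficient (applyUpTo f N)

tabulated-correct : ∀ {N} f → f ≈[mod-q^ N ] tabulated N f
tabulated-correct {suc N} f .at {zero}  _   = refl
tabulated-correct {suc N} f .at {suc n} n<N =
  tabulated-correct (f ∘ suc) .at (s<s⁻¹ n<N)

module Tabulated (N : ℕ) where

  infixl 7 _*ₜ_ _/ₜ_
  infixr 8 _^ₜ_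

  _*ₜ_ _/ₜ_ : Series → Series → Series
  f *ₜ g = tabulated N (f * g)
  f /ₜ g = tabulated N (f / g)

  _^ₜ_ : Series → ℕ → Series
  f ^ₜ zero  = 1#
  f ^ₜ suc k = f *ₜ f ^ₜ k

  qPochₜ : Series → Series → ℕ → Series
  qPochₜ a b zero    = 1#
  -- The difference stays untabulated, since each of its coefficients needs only one lookup in a
  -- table.
  qPochₜ a b (suc m) = qPochₜ a b m *ₜ (1# - a *ₜ b ^ₜ m)

  *ₜ-correct : ∀ {f f′ g g′} → f ≈[mod-q^ N ] f′ → g ≈[mod-q^ N ] g′ →
               f * g ≈[mod-q^ N ] f′ *ₜ g′
  *ₜ-correct f≈f′ g≈g′ =
    ≈-trans (*-cong f≈f′ g≈g′) (tabulated-correct _)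

  /ₜ-correct : ∀ {f f′ g g′} → f ≈[mod-q^ N ] f′ → g ≈[mod-q^ N ] g′ →
               f / g ≈[mod-q^ N ] f′ /ₜ g′
  /ₜ-correct f≈f′ g≈g′ =
    ≈-trans (/-cong f≈f′ g≈g′) (tabulated-correct _)

  ^ₜ-correct : ∀ {f f′} → f ≈[mod-q^ N ] f′ →
               ∀ k → f ^ k ≈[mod-q^ N ] f′ ^ₜ k
  ^ₜ-correct f≈f′ zero    = ≈-refl
  ^ₜ-correct f≈f′ (suc k) = *ₜ-correct f≈f′ (^ₜ-correct f≈f′ k)

  qPochₜ-correct : ∀ {a a′ b b′} → a ≈[mod-q^ N ] a′ → b ≈[mod-q^ N ] b′ →
                   ∀ m → qPoch a b m ≈[mod-q^ N ] qPochₜ a′ b′ m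
  qPochₜ-correct a≈a′ b≈b′ zero    = ≈-refl
  qPochₜ-correct a≈a′ b≈b′ (suc m) =
    *ₜ-correct (qPochₜ-correct a≈a′ b≈b′ m)
      (sub-cong (≈-refl {f = 1#}) (*ₜ-correct a≈a′ (^ₜ-correct b≈b′ m)))

  -- `qPoch∞` truncates the product at a point that depends on the coefficient. By
  -- `qPoch-converges`, the product of `N` factors is right at every index below `N`, so one table
  -- serves them all.
  qPoch∞-correct : ∀ {a a′ b b′} → b 0 ≡ 0ℤ →
                   a ≈[mod-q^ N ] a′ → b ≈[mod-q^ N ] b′ →
                   qPoch∞ a b ≈[mod-q^ N ] qPochₜ a′ b′ N
  qPoch∞-correct {a} {b = b} b₀≡0 a≈a′ b≈b′ .at {n} n<N =
    trans (sym (qPoch-converges a b b₀≡0 n N n<N))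
          (qPochₜ-correct a≈a′ b≈b′ N .at n<N)

  Pₜ : ℕ → Series
  Pₜ j = qPochₜ (q ^ₜ j) (q ^ₜ 5) N

  Rₜ Aₜ : Series
  -- Not `Pₜ 1`: `R` has `q` here, which is not definitionally `q ^ 1`.
  Rₜ = (qPochₜ q (q ^ₜ 5) N *ₜ Pₜ 4) /ₜ (Pₜ 2 *ₜ Pₜ 3)
  Aₜ = 1# /ₜ Rₜ ^ₜ 5

  Aₜ-correct : A ≈[mod-q^ N ] Aₜ
  Aₜ-correct = /ₜ-correct (≈-refl {f = 1#}) (^ₜ-correct Rₜ-correct 5)
    where
    q^ₜ-correct : ∀ k → q ^ k ≈[mod-q^ N ] q ^ₜ k
    q^ₜ-correct = ^ₜ-correct ≈-refl

    Pₜ-correct : ∀ j → qPoch∞ (q ^ j) (q ^ 5) ≈[mod-q^ N ] Pₜ j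
    Pₜ-correct j = qPoch∞-correct refl (q^ₜ-correct j) (q^ₜ-correct 5)

    Rₜ-correct : R ≈[mod-q^ N ] Rₜ
    Rₜ-correct = /ₜ-correct
      (*ₜ-correct (qPoch∞-correct refl ≈-refl (q^ₜ-correct 5)) (Pₜ-correct 4))
      (*ₜ-correct (Pₜ-correct 2) (Pₜ-correct 3))

-- The least `N` above 15, the largest index in the theorem.
open Tabulated 16

theorem1p6 : (A 0 > 0ℤ) × (A 10 < 0ℤ) × (A 15 < 0ℤ)
theorem1p6 =
    -- The sign is decided by evaluating tabulated series only; `subst` carries the outcome over to
    -- `A`.
    subst (_> 0ℤ) (sym (Aₜ-correct .at {0} z<s))
      (toWitness {a? = 0ℤ ℤ.<? Aₜ 0} _)
  , subst (_< 0ℤ) (sym (Aₜ-correct .at {10} (ℕ.m≤m+n 11 5)))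
      (toWitness {a? = Aₜ 10 ℤ.<? 0ℤ} _)
  , subst (_< 0ℤ) (sym (Aₜ-correct .at {15} (ℕ.n<1+n 15)))
      (toWitness {a? = Aₜ 15 ℤ.<? 0ℤ} _)
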